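{- For every integer $d\ge 2$ there exist a positive integer $n$, a matrix $A\in\mathbb{Z}^{d\times n}$ with column vectors $a_1,\ldots,a_n$, and a vector $b\in\mathbb{Z}^d$ such that, setting $\Delta=\max_{i=1}^n\lceil\|a_i\|\rceil$ and $t=\frac{\Delta^d}{20d}$, one has $$b\in\mathcal{L}(A)\cap\{A x\mid x\in\mathbb{R}^n,\ x\ge t\cdot\mathbf{1}\},$$ but there does not exist $x\in\mathbb{Z}_{\ge 0}^n$ such that $b=Ax$.
   Context: $\|\cdot\|$ is the Euclidean norm on $\mathbb{R}^d$. $\mathcal{L}(A)=\{Az\mid z\in\mathbb{Z}^n\}$ is the lattice generated by the columns of $A$. $\mathbf{1}$ is the all-ones vector in $\mathbb{R}^n$, and vector inequalities are coordinatewise. -}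

module Defs where

open import Algebra.Bundles.Raw using (RawSemiring)
open import Algebra.Definitions.RawMonoid using (sum)
open import Data.Empty using (⊥-elim)
open import Data.Fin.Base using (Fin)
open import Data.Integer.Base as ℤ using (ℤ; +_)
import Data.Integer.Properties as ℤ
open import Data.Nat.Base as ℕ using (ℕ; zero; suc; z≤n; s≤s)
import Data.Nat.Properties as ℕ
open import Data.Product.Base using (Σ; ∃; ∃-syntax; Σ-syntax; _×_; _,_; proj₁; proj₂)
open import Data.Rational.Base
  using (ℚ; mkℚ; 0ℚ; 1ℚ; ½; _/_; _+_; _-_; _*_; -_; 1/_; ∣_∣; _≤_; _<_; toℚᵘ; *<*;
         NonNegative; Positive; nonNegative; positive)
open import Data.Rational.Properties
import Data.Rational.Unnormalised.Base as ℚᵘ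
import Data.Rational.Unnormalised.Properties as ℚᵘ
open import Data.Rational.Solver using (module +-*-Solver)
open import Data.Sum.Base using (inj₁; inj₂)
open import Data.Vec.Functional as Vector using (Vector)
open import Level using (0ℓ)
open import Relation.Binary.PropositionalEquality
  using (_≡_; refl; sym; trans; cong; cong₂; subst₂; module ≡-Reasoning)
open import Relation.Nullary using (yes; no)
open import Relation.Unary using (Pred)

module Aux where
  ι : ℤ → ℚ
  ι i = i / 1

  toℚᵘ-ι : ∀ i → toℚᵘ (ι i) ℚᵘ.≃ ℚᵘ.mkℚᵘ i 0
  toℚᵘ-ι i = toℚᵘ-fromℚᵘ (ℚᵘ.mkℚᵘ i 0)

  ι-* : ∀ i j → ι (i ℤ.* j) ≡ ι i * ι j
  ι-* i j = toℚᵘ-injective (ℚᵘ.≃-trans (toℚᵘ-ι (i ℤ.* j)) (ℚᵘ.≃-sym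
    (ℚᵘ.≃-trans (toℚᵘ-homo-* (ι i) (ι j)) (ℚᵘ.*-cong (toℚᵘ-ι i) (toℚᵘ-ι j)))))

  ι-+ : ∀ i j → ι (i ℤ.+ j) ≡ ι i + ι j
  ι-+ i j = toℚᵘ-injective (ℚᵘ.≃-trans (toℚᵘ-ι (i ℤ.+ j)) (ℚᵘ.≃-sym
    (ℚᵘ.≃-trans (toℚᵘ-homo-+ (ι i) (ι j)) (ℚᵘ.≃-trans (ℚᵘ.+-cong (toℚᵘ-ι i) (toℚᵘ-ι j))
      (ℚᵘ.*≡* (cong (ℤ._* + 1) (cong₂ ℤ._+_ (ℤ.*-identityʳ i) (ℤ.*-identityʳ j))))))))

  ι-mono-≤ : ∀ {i j} → i ℤ.≤ j → ι i ≤ ι j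
  ι-mono-≤ {i} {j} i≤j = toℚᵘ-cancel-≤
    (ℚᵘ.≤-respˡ-≃ (ℚᵘ.≃-sym (toℚᵘ-ι i)) (ℚᵘ.≤-respʳ-≃ (ℚᵘ.≃-sym (toℚᵘ-ι j))
      (ℚᵘ.*≤* (ℤ.*-monoʳ-≤-nonNeg (+ 1) i≤j))))

  ι-mono-< : ∀ {i j} → i ℤ.< j → ι i < ι j
  ι-mono-< {i} {j} i<j = toℚᵘ-cancel-<
    (ℚᵘ.<-respˡ-≃ (ℚᵘ.≃-sym (toℚᵘ-ι i)) (ℚᵘ.<-respʳ-≃ (ℚᵘ.≃-sym (toℚᵘ-ι j))
      (ℚᵘ.*<* (ℤ.*-monoʳ-<-pos (+ 1) i<j))))

  ι-nonNeg : ∀ n → 0ℚ ≤ ι (+ n)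
  ι-nonNeg n = ι-mono-≤ {+ 0} {+ n} (ℤ.+≤+ z≤n)

  -- h n = 1/(n+1)
  h : ℕ → ℚ
  h n = + 1 / suc n

  ι*h : ∀ n → ι (+ suc n) * h n ≡ 1ℚ
  ι*h n = toℚᵘ-injective (ℚᵘ.≃-trans (toℚᵘ-homo-* (ι (+ suc n)) (h n))
    (ℚᵘ.≃-trans (ℚᵘ.*-cong (toℚᵘ-ι (+ suc n)) (toℚᵘ-fromℚᵘ (ℚᵘ.mkℚᵘ (+ 1) n)))
      (ℚᵘ.*≡* (trans (ℤ.*-identityʳ (+ suc n ℤ.* + 1)) (trans (ℤ.*-identityʳ (+ suc n))
        (sym (trans (ℤ.*-identityˡ (+ 1 ℤ.* + suc n)) (ℤ.*-identityˡ (+ suc n)))))))))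

  h-antimono : ∀ {m n} → m ℕ.≤ n → h n ≤ h m
  h-antimono {m} {n} m≤n = toℚᵘ-cancel-≤
    (ℚᵘ.≤-respˡ-≃ (ℚᵘ.≃-sym (toℚᵘ-fromℚᵘ (ℚᵘ.mkℚᵘ (+ 1) n)))
    (ℚᵘ.≤-respʳ-≃ (ℚᵘ.≃-sym (toℚᵘ-fromℚᵘ (ℚᵘ.mkℚᵘ (+ 1) m)))
      (ℚᵘ.*≤* (ℤ.*-monoˡ-≤-nonNeg (+ 1) (ℤ.+≤+ (s≤s m≤n))))))

  h>0 : ∀ n → 0ℚ < h n
  h>0 n = toℚᵘ-cancel-< (ℚᵘ.<-respʳ-≃ (ℚᵘ.≃-sym (toℚᵘ-fromℚᵘ (ℚᵘ.mkℚᵘ (+ 1) n)))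
    (ℚᵘ.positive⁻¹ (ℚᵘ.mkℚᵘ (+ 1) n)))

  archimedean : ∀ {ε} → 0ℚ < ε → ∃[ N ] h N ≤ ε
  archimedean {mkℚ (+ suc p) q _} _ = q , toℚᵘ-cancel-≤
    (ℚᵘ.≤-respˡ-≃ (ℚᵘ.≃-sym (toℚᵘ-fromℚᵘ (ℚᵘ.mkℚᵘ (+ 1) q)))
      (ℚᵘ.*≤* (ℤ.*-monoʳ-≤-nonNeg (+ suc q) {+ 1} {+ suc p} (ℤ.+≤+ (s≤s z≤n)))))
  archimedean {mkℚ (+ zero) q _} (*<* (ℤ.+<+ ()))
  archimedean {mkℚ ℤ.-[1+ n ] q _} (*<* ())

  *-pos : ∀ {p q} → 0ℚ < p → 0ℚ < q → 0ℚ < p * q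
  *-pos {p} {q} p>0 q>0 =
    positive⁻¹ (p * q) {{pos*pos⇒pos p {{positive p>0}} q {{positive q>0}}}}

  ½>0 : 0ℚ < ½
  ½>0 = positive⁻¹ ½

  ½+½ : ∀ ε → ε * ½ + ε * ½ ≡ ε
  ½+½ ε = trans (sym (*-distribˡ-+ ε ½ ½)) (*-identityʳ ε)

  *-mono : ∀ {p q r s} → 0ℚ ≤ p → 0ℚ ≤ s → p ≤ q → r ≤ s → p * r ≤ q * s
  *-mono {p} {q} {r} {s} p≥0 s≥0 p≤q r≤s = ≤-trans
    (*-monoˡ-≤-nonNeg p {{nonNegative p≥0}} r≤s)
    (*-monoʳ-≤-nonNeg s {{nonNegative s≥0}} p≤q)

  ∣∣≤ : ∀ {p ε} → p ≤ ε → - p ≤ ε → ∣ p ∣ ≤ ε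
  ∣∣≤ {p} p≤ε -p≤ε with ∣p∣≡p∨∣p∣≡-p p
  ... | inj₁ eq = ≤-trans (≤-reflexive eq) p≤ε
  ... | inj₂ eq = ≤-trans (≤-reflexive eq) -p≤ε

  ≤+⇒-≤ : ∀ {p q ε} → p ≤ q + ε → p - q ≤ ε
  ≤+⇒-≤ {p} {q} {ε} le = ≤-trans (+-monoˡ-≤ (- q) le)
    (≤-reflexive (solve 2 (λ q ε → q :+ ε :- q := ε) refl q ε))
    where open +-*-Solver

  sq-cancel-< : ∀ {p q} → 0ℚ ≤ p → 0ℚ ≤ q → p * p < q * q → p < q
  sq-cancel-< {p} {q} p≥0 q≥0 lt with p <? q
  ... | yes p<q = p<q
  ... | no  p≮q =
    ⊥-elim (<-irrefl refl (<-≤-trans lt (*-mono q≥0 p≥0 (≮⇒≥ p≮q) (≮⇒≥ p≮q))))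

  sq-cancel-≤ : ∀ {p q} → 0ℚ ≤ p → 0ℚ ≤ q → p * p ≤ q * q → p ≤ q
  sq-cancel-≤ {p} {q} p≥0 q≥0 le with p ≤? q
  ... | yes p≤q = p≤q
  ... | no  p≰q = ⊥-elim (<-irrefl refl (<-≤-trans q²<p² le))
    where
    q<p = ≰⇒> p≰q
    q²<p² : q * q < p * p
    q²<p² = ≤-<-trans (*-monoˡ-≤-nonNeg q {{nonNegative q≥0}} (<⇒≤ q<p))
      (*-monoˡ-<-pos p {{positive (≤-<-trans q≥0 q<p)}} q<p)

  rearrange-+ : ∀ a b c d → a + b - (c + d) ≡ (a - c) + (b - d)
  rearrange-+ = solve 4 (λ a b c d → a :+ b :- (c :+ d) := (a :- c) :+ (b :- d)) refl
    where open +-*-Solver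

  rearrange-* : ∀ a b c d → a * b - c * d ≡ a * (b - d) + (a - c) * d
  rearrange-* a b c d = begin
      a * b - c * d                          ≡⟨ cong (_- c * d) (sym (+-identityʳ (a * b))) ⟩
      a * b + 0ℚ - c * d                     ≡⟨ cong (λ z → a * b + z - c * d) (sym (+-inverseˡ (a * d))) ⟩
      a * b + (- (a * d) + a * d) - c * d    ≡⟨ cong (_- c * d) (sym (+-assoc (a * b) (- (a * d)) (a * d))) ⟩
      (a * b - a * d) + a * d - c * d        ≡⟨ +-assoc (a * b - a * d) (a * d) (- (c * d)) ⟩
      (a * b - a * d) + (a * d - c * d)      ≡⟨ cong₂ _+_
        (trans (cong (λ z → a * b + z) (neg-distribʳ-* a d)) (sym (*-distribˡ-+ a b (- d))))
        (trans (cong (λ z → a * d + z) (neg-distribˡ-* c d)) (sym (*-distribʳ-+ d a (- c)))) ⟩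
      a * (b - d) + (a - c) * d              ∎
    where open ≡-Reasoning

  divide : ∀ {B ε} → 0ℚ < B → 0ℚ < ε → ∃[ δ ] 0ℚ < δ × B * δ ≡ ε
  divide {B} {ε} B>0 ε>0 = ε * 1/ B , *-pos ε>0 (positive⁻¹ (1/ B) {{1/pos⇒pos B}}) ,
    trans (*-comm B (ε * 1/ B)) (trans (*-assoc ε (1/ B) B)
      (trans (cong (ε *_) (*-inverseˡ B)) (*-identityʳ ε)))
    where
    instance
      posB = positive B>0
      nzB  = pos⇒nonZero B

  split : ∀ a b c d {B δ ε} → 0ℚ < B → 0ℚ < δ → ∣ a ∣ ≤ B → ∣ d ∣ ≤ B →
    ∣ a - c ∣ ≤ δ → ∣ b - d ∣ ≤ δ → B * δ + δ * B ≡ ε → ∣ a * b - c * d ∣ ≤ ε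
  split a b c d {B} {δ} {ε} B>0 δ>0 a≤B d≤B ac bd eq = begin
      ∣ a * b - c * d ∣                          ≡⟨ cong ∣_∣ (rearrange-* a b c d) ⟩
      ∣ a * (b - d) + (a - c) * d ∣              ≤⟨ ∣p+q∣≤∣p∣+∣q∣ (a * (b - d)) ((a - c) * d) ⟩
      ∣ a * (b - d) ∣ + ∣ (a - c) * d ∣          ≡⟨ cong₂ _+_ (∣p*q∣≡∣p∣*∣q∣ a (b - d)) (∣p*q∣≡∣p∣*∣q∣ (a - c) d) ⟩
      ∣ a ∣ * ∣ b - d ∣ + ∣ a - c ∣ * ∣ d ∣      ≤⟨ +-mono-≤
        (*-mono (0≤∣p∣ a) (<⇒≤ δ>0) a≤B bd) (*-mono (0≤∣p∣ (a - c)) (<⇒≤ B>0) ac d≤B) ⟩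
      B * δ + δ * B                              ≡⟨ eq ⟩
      ε                                          ∎
    where open ≤-Reasoning

  isqrt : ∀ M → ∃[ m ] m ℕ.* m ℕ.≤ M × M ℕ.< suc m ℕ.* suc m
  isqrt zero = 0 , z≤n , s≤s z≤n
  isqrt (suc M) with isqrt M
  ... | m , lo , hi with suc m ℕ.* suc m ℕ.≤? suc M
  ...   | yes le = suc m , le ,
            ℕ.≤-<-trans hi (ℕ.*-mono-< (ℕ.n<1+n (suc m)) (ℕ.n<1+n (suc m)))
  ...   | no nle = m , ℕ.≤-trans lo (ℕ.n≤1+n M) , ℕ.≰⇒> nle

open Aux

------------------------------------------------------------------------
-- The real numbers, as Cauchy sequences of rationals

record ℝ : Set where
  constructor mkℝ
  field
    seq    : ℕ → ℚ
    cauchy : ∀ ε → 0ℚ < ε → ∃[ N ] (∀ m n → N ℕ.≤ m → N ℕ.≤ n → ∣ seq m - seq n ∣ ≤ ε)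

open ℝ public

Eventually : (ℕ → Set) → Set
Eventually P = ∃[ N ] (∀ n → N ℕ.≤ n → P n)

infix 4 _≈ᴿ_ _≤ᴿ_ _<ᴿ_

_≈ᴿ_ : ℝ → ℝ → Set
x ≈ᴿ y = ∀ ε → 0ℚ < ε → Eventually (λ n → ∣ seq x n - seq y n ∣ ≤ ε)

_≤ᴿ_ : ℝ → ℝ → Set
x ≤ᴿ y = ∀ ε → 0ℚ < ε → Eventually (λ n → seq x n ≤ seq y n + ε)

_<ᴿ_ : ℝ → ℝ → Set
x <ᴿ y = ∃[ ε ] 0ℚ < ε × Eventually (λ n → seq x n + ε ≤ seq y n)

fromℚ : ℚ → ℝ
seq    (fromℚ q) _ = q
cauchy (fromℚ q) ε ε>0 =
  0 , λ _ _ _ _ → ≤-trans (≤-reflexive (cong ∣_∣ (+-inverseʳ q))) (<⇒≤ ε>0)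

fromℤ : ℤ → ℝ
fromℤ i = fromℚ (i / 1)

infixl 6 _+ᴿ_
infixl 7 _*ᴿ_

_+ᴿ_ : ℝ → ℝ → ℝ
seq    (x +ᴿ y) n = seq x n + seq y n
cauchy (x +ᴿ y) ε ε>0 = Nx ℕ.⊔ Ny , λ m n N≤m N≤n → begin
    ∣ seq x m + seq y m - (seq x n + seq y n) ∣      ≡⟨ cong ∣_∣ (rearrange-+ (seq x m) (seq y m) (seq x n) (seq y n)) ⟩
    ∣ (seq x m - seq x n) + (seq y m - seq y n) ∣    ≤⟨ ∣p+q∣≤∣p∣+∣q∣ (seq x m - seq x n) (seq y m - seq y n) ⟩
    ∣ seq x m - seq x n ∣ + ∣ seq y m - seq y n ∣    ≤⟨ +-mono-≤
      (cx m n (ℕ.m⊔n≤o⇒m≤o Nx Ny N≤m) (ℕ.m⊔n≤o⇒m≤o Nx Ny N≤n))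
      (cy m n (ℕ.m⊔n≤o⇒n≤o Nx Ny N≤m) (ℕ.m⊔n≤o⇒n≤o Nx Ny N≤n)) ⟩
    ε * ½ + ε * ½                                    ≡⟨ ½+½ ε ⟩
    ε                                                ∎
  where
  open ≤-Reasoning
  δ>0 = *-pos ε>0 ½>0
  Nx = proj₁ (cauchy x (ε * ½) δ>0)
  cx = proj₂ (cauchy x (ε * ½) δ>0)
  Ny = proj₁ (cauchy y (ε * ½) δ>0)
  cy = proj₂ (cauchy y (ε * ½) δ>0)

private
  bounded : ∀ x → ∃[ B ] 0ℚ < B × Eventually (λ n → ∣ seq x n ∣ ≤ B)
  bounded x = ∣ seq x N ∣ + 1ℚ , +-mono-≤-< (0≤∣p∣ (seq x N)) (positive⁻¹ 1ℚ) , N , λ n N≤n → begin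
      ∣ seq x n ∣                              ≡⟨ cong ∣_∣ (solve 2 (λ a b → a := b :+ (a :- b)) refl (seq x n) (seq x N)) ⟩
      ∣ seq x N + (seq x n - seq x N) ∣        ≤⟨ ∣p+q∣≤∣p∣+∣q∣ (seq x N) (seq x n - seq x N) ⟩
      ∣ seq x N ∣ + ∣ seq x n - seq x N ∣      ≤⟨ +-monoʳ-≤ ∣ seq x N ∣ (c n N N≤n ℕ.≤-refl) ⟩
      ∣ seq x N ∣ + 1ℚ                         ∎
    where
    open ≤-Reasoning
    open +-*-Solver
    N = proj₁ (cauchy x 1ℚ (positive⁻¹ 1ℚ))
    c = proj₂ (cauchy x 1ℚ (positive⁻¹ 1ℚ))

  *-cauchy : ∀ x y {Bx By} → 0ℚ < Bx → 0ℚ < By →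
    Eventually (λ n → ∣ seq x n ∣ ≤ Bx) → Eventually (λ n → ∣ seq y n ∣ ≤ By) →
    ∀ ε → 0ℚ < ε →
    ∃[ N ] (∀ m n → N ℕ.≤ m → N ℕ.≤ n → ∣ seq x m * seq y m - seq x n * seq y n ∣ ≤ ε)
  *-cauchy x y {Bx} {By} Bx>0 By>0 (Mx , bx) (My , by) ε ε>0 =
    (Mx ℕ.⊔ My) ℕ.⊔ (Nx ℕ.⊔ Ny) , λ m n N≤m N≤n →
      let M≤m = ℕ.m⊔n≤o⇒m≤o (Mx ℕ.⊔ My) (Nx ℕ.⊔ Ny) N≤m
          M≤n = ℕ.m⊔n≤o⇒m≤o (Mx ℕ.⊔ My) (Nx ℕ.⊔ Ny) N≤n
          K≤m = ℕ.m⊔n≤o⇒n≤o (Mx ℕ.⊔ My) (Nx ℕ.⊔ Ny) N≤m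
          K≤n = ℕ.m⊔n≤o⇒n≤o (Mx ℕ.⊔ My) (Nx ℕ.⊔ Ny) N≤n
      in split (seq x m) (seq y m) (seq x n) (seq y n) B>0 δ>0
        (≤-trans (bx m (ℕ.m⊔n≤o⇒m≤o Mx My M≤m)) Bx≤B)
        (≤-trans (by n (ℕ.m⊔n≤o⇒n≤o Mx My M≤n)) By≤B)
        (cx m n (ℕ.m⊔n≤o⇒m≤o Nx Ny K≤m) (ℕ.m⊔n≤o⇒m≤o Nx Ny K≤n))
        (cy m n (ℕ.m⊔n≤o⇒n≤o Nx Ny K≤m) (ℕ.m⊔n≤o⇒n≤o Nx Ny K≤n))
        Bδ+δB≡ε
    where
    B = Bx + By
    B>0 : 0ℚ < B
    B>0 = +-mono-< Bx>0 By>0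
    Bx≤B : Bx ≤ B
    Bx≤B = ≤-trans (≤-reflexive (sym (+-identityʳ Bx))) (+-monoʳ-≤ Bx (<⇒≤ By>0))
    By≤B : By ≤ B
    By≤B = ≤-trans (≤-reflexive (sym (+-identityˡ By))) (+-monoˡ-≤ By (<⇒≤ Bx>0))
    quotient = divide B>0 (*-pos ε>0 ½>0)
    δ = proj₁ quotient
    δ>0 = proj₁ (proj₂ quotient)
    Bδ+δB≡ε : B * δ + δ * B ≡ ε
    Bδ+δB≡ε = trans (cong₂ _+_ (proj₂ (proj₂ quotient))
      (trans (*-comm δ B) (proj₂ (proj₂ quotient)))) (½+½ ε)
    Nx = proj₁ (cauchy x δ δ>0)
    cx = proj₂ (cauchy x δ δ>0)
    Ny = proj₁ (cauchy y δ δ>0)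
    cy = proj₂ (cauchy y δ δ>0)

_*ᴿ_ : ℝ → ℝ → ℝ
seq    (x *ᴿ y) n = seq x n * seq y n
cauchy (x *ᴿ y) =
  let Bx , Bx>0 , bx = bounded x
      By , By>0 , by = bounded y
  in *-cauchy x y Bx>0 By>0 bx by

ℝ-rawSemiring : RawSemiring 0ℓ 0ℓ
ℝ-rawSemiring = record
  { Carrier = ℝ
  ; _≈_     = _≈ᴿ_
  ; _+_     = _+ᴿ_
  ; _*_     = _*ᴿ_
  ; 0#      = fromℚ 0ℚ
  ; 1#      = fromℚ 1ℚ
  }

IsSqrt : ℝ → ℝ → Set
IsSqrt x r = fromℚ 0ℚ ≤ᴿ r × r *ᴿ r ≈ᴿ x

-- k = ⌈x⌉
IsCeiling : ℝ → ℤ → Set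
IsCeiling x k = fromℤ (k ℤ.- + 1) <ᴿ x × x ≤ᴿ fromℤ k

-- The n-th approximant of √N is ⌊√(N(n+1)²)⌋ / (n+1).
module Sqrt (N : ℕ) where

  root : ℕ → ℕ
  root n = proj₁ (isqrt (N ℕ.* (suc n ℕ.* suc n)))

  s : ℕ → ℚ
  s n = ι (+ root n) * h n

  s≥0 : ∀ n → 0ℚ ≤ s n
  s≥0 n = ≤-trans (≤-reflexive (sym (*-zeroʳ 0ℚ)))
    (*-mono ≤-refl (<⇒≤ (h>0 n)) (ι-nonNeg (root n)) (<⇒≤ (h>0 n)))

  open +-*-Solver

  -- N(n+1)²·h(n)² = N
  scale : ∀ n → ι (+ (N ℕ.* (suc n ℕ.* suc n))) * (h n * h n) ≡ ι (+ N)
  scale n = begin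
    ι (+ (N ℕ.* (suc n ℕ.* suc n))) * (h n * h n)
      ≡⟨ cong (λ z → ι z * (h n * h n)) (trans (ℤ.pos-* N (suc n ℕ.* suc n)) (cong (+ N ℤ.*_) (ℤ.pos-* (suc n) (suc n)))) ⟩
    ι (+ N ℤ.* (+ suc n ℤ.* + suc n)) * (h n * h n)
      ≡⟨ cong (_* (h n * h n)) (trans (ι-* (+ N) (+ suc n ℤ.* + suc n)) (cong (ι (+ N) *_) (ι-* (+ suc n) (+ suc n)))) ⟩
    ι (+ N) * (ι (+ suc n) * ι (+ suc n)) * (h n * h n)
      ≡⟨ solve 3 (λ a b c → a :* (b :* b) :* (c :* c) := a :* ((b :* c) :* (b :* c))) refl (ι (+ N)) (ι (+ suc n)) (h n) ⟩
    ι (+ N) * ((ι (+ suc n) * h n) * (ι (+ suc n) * h n))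
      ≡⟨ cong (λ z → ι (+ N) * (z * z)) (ι*h n) ⟩
    ι (+ N) * (1ℚ * 1ℚ)
      ≡⟨ *-identityʳ (ι (+ N)) ⟩
    ι (+ N) ∎
    where open ≡-Reasoning

  square : ∀ m n → ι (+ (m ℕ.* m)) * (h n * h n) ≡ (ι (+ m) * h n) * (ι (+ m) * h n)
  square m n = trans (cong (_* (h n * h n)) (trans (cong ι (ℤ.pos-* m m)) (ι-* (+ m) (+ m))))
    (solve 2 (λ a b → a :* a :* (b :* b) := a :* b :* (a :* b)) refl (ι (+ m)) (h n))

  s+h : ∀ n → ι (+ suc (root n)) * h n ≡ s n + h n
  s+h n = trans (cong (_* h n) (ι-+ (+ 1) (+ root n)))
    (solve 2 (λ a b → (con 1ℚ :+ a) :* b := a :* b :+ b) refl (ι (+ root n)) (h n))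

  h²>0 : ∀ n → 0ℚ < h n * h n
  h²>0 n = *-pos (h>0 n) (h>0 n)

  lower : ∀ n → s n * s n ≤ ι (+ N)
  lower n = subst₂ _≤_ (square (root n) n) (scale n)
    (*-monoʳ-≤-nonNeg (h n * h n) {{nonNegative (<⇒≤ (h²>0 n))}}
      (ι-mono-≤ (ℤ.+≤+ (proj₁ (proj₂ (isqrt (N ℕ.* (suc n ℕ.* suc n))))))))

  upper : ∀ n → ι (+ N) < (s n + h n) * (s n + h n)
  upper n = subst₂ _<_ (scale n) (trans (square (suc (root n)) n) (cong (λ z → z * z) (s+h n)))
    (*-monoˡ-<-pos (h n * h n) {{positive (h²>0 n)}}
      (ι-mono-< (ℤ.+<+ (proj₂ (proj₂ (isqrt (N ℕ.* (suc n ℕ.* suc n))))))))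

  s+h≥0 : ∀ n → 0ℚ ≤ s n + h n
  s+h≥0 n = +-mono-≤ (s≥0 n) (<⇒≤ (h>0 n))

  compare : ∀ m n → s m ≤ s n + h n
  compare m n = <⇒≤ (sq-cancel-< (s≥0 m) (s+h≥0 n) (≤-<-trans (lower m) (upper n)))

  root-ℝ : ℝ
  seq    root-ℝ = s
  cauchy root-ℝ ε ε>0 with archimedean ε>0
  ... | K , hK≤ε = K , λ m n K≤m K≤n → ∣∣≤
    (≤-trans (≤+⇒-≤ (compare m n)) (≤-trans (h-antimono K≤n) hK≤ε))
    (≤-trans (≤-reflexive (solve 2 (λ a b → :- (a :- b) := b :- a) refl (s m) (s n)))
      (≤-trans (≤+⇒-≤ (compare n m)) (≤-trans (h-antimono K≤m) hK≤ε)))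

  root≥0 : fromℚ 0ℚ ≤ᴿ root-ℝ
  root≥0 ε ε>0 = 0 , λ n _ → +-mono-≤ (s≥0 n) (<⇒≤ ε>0)

  s≤N : ∀ n → s n ≤ ι (+ N)
  s≤N n = sq-cancel-≤ (s≥0 n) (ι-nonNeg N) (≤-trans (lower n) N≤N²)
    where
    N≤N² : ι (+ N) ≤ ι (+ N) * ι (+ N)
    N≤N² = ≤-trans (ι-mono-≤ (ℤ.+≤+ (go N)))
      (≤-reflexive (trans (cong ι (ℤ.pos-* N N)) (ι-* (+ N) (+ N))))
      where
      go : ∀ k → k ℕ.≤ k ℕ.* k
      go zero    = z≤n
      go (suc k) = ℕ.m≤m*n (suc k) (suc k)

  h≤1 : ∀ n → h n ≤ 1ℚ
  h≤1 n = h-antimono {0} {n} z≤n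

  C : ℚ
  C = ι (+ N) + ι (+ N) + 1ℚ

  C>0 : 0ℚ < C
  C>0 = +-mono-≤-< (+-mono-≤ (ι-nonNeg N) (ι-nonNeg N)) (positive⁻¹ 1ℚ)

  root² : root-ℝ *ᴿ root-ℝ ≈ᴿ fromℤ (+ N)
  root² ε ε>0 = K , λ n K≤n → ∣∣≤
      (≤-trans (≤+⇒-≤ (≤-trans (lower n) (≤-reflexive (sym (+-identityʳ _))))) (<⇒≤ ε>0))
      (begin
        - (s n * s n - ι (+ N))                        ≡⟨ solve 2 (λ a b → :- (a :- b) := b :- a) refl (s n * s n) (ι (+ N)) ⟩
        ι (+ N) - s n * s n                            ≤⟨ +-monoˡ-≤ (- (s n * s n)) (<⇒≤ (upper n)) ⟩
        (s n + h n) * (s n + h n) - s n * s n          ≡⟨ solve 2 (λ a b → (a :+ b) :* (a :+ b) :- a :* a := (a :+ a :+ b) :* b) refl (s n) (h n) ⟩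
        (s n + s n + h n) * h n                        ≤⟨ *-mono (+-mono-≤ (+-mono-≤ (s≥0 n) (s≥0 n)) (<⇒≤ (h>0 n))) (<⇒≤ δ>0)
                                                            (+-mono-≤ (+-mono-≤ (s≤N n) (s≤N n)) (h≤1 n))
                                                            (≤-trans (h-antimono K≤n) hK≤δ) ⟩
        C * (ε * 1/ C)                                 ≡⟨ solve 3 (λ a b c → a :* (b :* c) := b :* (a :* c)) refl C ε (1/ C) ⟩
        ε * (C * 1/ C)                                 ≡⟨ cong (ε *_) (*-inverseʳ C) ⟩
        ε * 1ℚ                                         ≡⟨ *-identityʳ ε ⟩
        ε                                              ∎)
    where
    open ≤-Reasoning
    instance
      posC = positive C>0
      nzC  = pos⇒nonZero C
    δ>0 : 0ℚ < ε * 1/ C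
    δ>0 = *-pos ε>0 (positive⁻¹ (1/ C) {{1/pos⇒pos C}})
    K = proj₁ (archimedean δ>0)
    hK≤δ = proj₂ (archimedean δ>0)

  ≤ceil : ∀ k → N ℕ.≤ k ℕ.* k → root-ℝ ≤ᴿ fromℤ (+ k)
  ≤ceil k N≤k² ε ε>0 = 0 , λ n _ → ≤-trans
    (sq-cancel-≤ (s≥0 n) (ι-nonNeg k) (≤-trans (lower n) (≤-trans (ι-mono-≤ (ℤ.+≤+ N≤k²))
      (≤-reflexive (trans (cong ι (ℤ.pos-* k k)) (ι-* (+ k) (+ k)))))))
    (≤-trans (≤-reflexive (sym (+-identityʳ _))) (+-monoʳ-≤ (ι (+ k)) (<⇒≤ ε>0)))

  <ceil : ∀ j → j ℕ.* j ℕ.< N → fromℤ (+ j) <ᴿ root-ℝ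
  <ceil j j²<N = δ * ½ , δ½>0 , K , λ n K≤n → begin
      J + δ * ½                        ≡⟨ solve 2 (λ a b → a :+ b := a :+ (b :+ b) :- b) refl J (δ * ½) ⟩
      J + (δ * ½ + δ * ½) - δ * ½      ≡⟨ cong (λ z → J + z - δ * ½) (½+½ δ) ⟩
      J + δ - δ * ½                    ≤⟨ +-mono-≤ (<⇒≤ (J+δ<s+h n)) (neg-antimono-≤ (≤-trans (h-antimono K≤n) hK≤)) ⟩
      s n + h n - h n                  ≡⟨ solve 2 (λ a b → a :+ b :- b := a) refl (s n) (h n) ⟩
      s n                              ∎
    where
    open ≤-Reasoning
    J = ι (+ j)
    -- (j+δ)² ≤ j²+1 for δ = 1/(2j+1)
    δ = h (j ℕ.+ j)
    δ½>0 = *-pos (h>0 (j ℕ.+ j)) ½>0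
    K = proj₁ (archimedean δ½>0)
    hK≤ = proj₂ (archimedean δ½>0)
    bound : (J + δ) * (J + δ) ≤ ι (+ N)
    bound = begin
      (J + δ) * (J + δ)              ≡⟨ solve 2 (λ a b → (a :+ b) :* (a :+ b) := (a :+ a :+ b) :* b :+ a :* a) refl J δ ⟩
      (J + J + δ) * δ + J * J        ≤⟨ +-monoˡ-≤ (J * J) (*-monoʳ-≤-nonNeg δ {{nonNegative (<⇒≤ (h>0 (j ℕ.+ j)))}}
                                          (+-monoʳ-≤ (J + J) (h≤1 (j ℕ.+ j)))) ⟩
      (J + J + 1ℚ) * δ + J * J       ≡⟨ cong (λ z → z * δ + J * J) (trans (+-comm (J + J) 1ℚ)
                                          (sym (trans (ι-+ (+ 1) (+ (j ℕ.+ j))) (cong (λ z → 1ℚ + z) (ι-+ (+ j) (+ j)))))) ⟩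
      ι (+ suc (j ℕ.+ j)) * δ + J * J ≡⟨ cong₂ _+_ (ι*h (j ℕ.+ j)) (sym (trans (cong ι (ℤ.pos-* j j)) (ι-* (+ j) (+ j)))) ⟩
      1ℚ + ι (+ (j ℕ.* j))           ≡⟨ sym (ι-+ (+ 1) (+ (j ℕ.* j))) ⟩
      ι (+ suc (j ℕ.* j))            ≤⟨ ι-mono-≤ (ℤ.+≤+ j²<N) ⟩
      ι (+ N)                        ∎
    J+δ<s+h : ∀ n → J + δ < s n + h n
    J+δ<s+h n = sq-cancel-< (+-mono-≤ (ι-nonNeg j) (<⇒≤ (h>0 (j ℕ.+ j)))) (s+h≥0 n)
      (≤-<-trans bound (upper n))

  ceil : ∃[ k ] IsCeiling root-ℝ (+ k)
  ceil with isqrt N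
  ... | m , m²≤N , N<[1+m]² with m ℕ.* m ℕ.<? N
  ...   | yes m²<N = suc m , <ceil m m²<N , ≤ceil (suc m) (ℕ.<⇒≤ N<[1+m]²)
  ...   | no  m²≮N = m , pred< m m²≤N , ≤ceil m (ℕ.≮⇒≥ m²≮N)
    where
    pred< : ∀ m → m ℕ.* m ℕ.≤ N → fromℤ (+ m ℤ.- + 1) <ᴿ root-ℝ
    pred< zero    _    = 1ℚ , positive⁻¹ 1ℚ , 0 , λ n _ → s≥0 n
    pred< (suc m) m²≤N = <ceil m (ℕ.<-≤-trans (ℕ.*-mono-< (ℕ.n<1+n m) (ℕ.n<1+n m)) m²≤N)

√ : (N : ℕ) → Σ[ r ∈ ℝ ] IsSqrt (fromℤ (+ N)) r
√ N = Sqrt.root-ℝ N , Sqrt.root≥0 N , Sqrt.root² N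

⌈√_⌉ : (N : ℕ) → Σ[ k ∈ ℕ ] IsCeiling (proj₁ (√ N)) (+ k)
⌈√ N ⌉ = Sqrt.ceil N

------------------------------------------------------------------------
-- Integer matrices and lattices

-- A i j is the entry in row i and column j.
Matrix : ∀ {c} → Set c → ℕ → ℕ → Set c
Matrix R d n = Fin d → Fin n → R

column : ∀ {c} {R : Set c} {d n} → Matrix R d n → Fin n → Vector R d
column A j i = A i j

module _ {c ℓ} (S : RawSemiring c ℓ) where
  private module S = RawSemiring S

  matVec : ∀ {d n} → Matrix S.Carrier d n → Vector S.Carrier n → Vector S.Carrier d
  matVec A x i = sum S.+-rawMonoid (λ j → A i j S.* x j)

infixr 7 _·ᶻ_ _·ᴿ_

_·ᶻ_ : ∀ {d n} → Matrix ℤ d n → Vector ℤ n → Vector ℤ d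
_·ᶻ_ = matVec ℤ.+-*-rawSemiring

_·ᴿ_ : ∀ {d n} → Matrix ℤ d n → Vector ℝ n → Vector ℝ d
A ·ᴿ x = matVec ℝ-rawSemiring (λ i j → fromℤ (A i j)) x

ℒ : ∀ {d n} → Matrix ℤ d n → Pred (Vector ℤ d) 0ℓ
ℒ A b = ∃[ z ] (∀ i → b i ≡ (A ·ᶻ z) i)

-- { A x ∣ x ∈ ℝⁿ, x ≥ t·𝟏 }
RealImage≥ : ∀ {d n} → Matrix ℤ d n → ℚ → Pred (Vector ℝ d) 0ℓ
RealImage≥ A t y = ∃[ x ] (∀ j → fromℚ t ≤ᴿ x j) × (∀ i → y i ≈ᴿ (A ·ᴿ x) i)

-- ‖a‖²; ∣ aᵢ ∣² is used in place of aᵢ² so that the sum is a natural number.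
normSq : ∀ {d} → Vector ℤ d → ℕ
normSq a = sum ℕ.+-0-rawMonoid (λ i → ℤ.∣ a i ∣ ℕ.* ℤ.∣ a i ∣)

‖_‖ : ∀ {d} → Vector ℤ d → ℝ
‖ a ‖ = proj₁ (√ (normSq a))

ceilNorm : ∀ {d} (a : Vector ℤ d) → Σ[ k ∈ ℕ ] IsCeiling ‖ a ‖ (+ k)
ceilNorm a = ⌈√ normSq a ⌉

⌈‖_‖⌉ : ∀ {d} → Vector ℤ d → ℕ
⌈‖ a ‖⌉ = proj₁ (ceilNorm a)

-- The base value 0 is immaterial as soon as there is at least one column.
Δ : ∀ {d n} → Matrix ℤ d n → ℕ
Δ A = Vector.foldr ℕ._⊔_ 0 (λ j → ⌈‖ column A j ‖⌉)

threshold : (d : ℕ) → 2 ℕ.≤ d → ℕ → ℚ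
threshold d 2≤d D = + (D ℕ.^ d) / (20 ℕ.* d)
  where
  instance
    d≢0   = ℕ.>-nonZero (ℕ.<-trans (s≤s z≤n) 2≤d)
    20d≢0 = ℕ.m*n≢0 20 d

{-# OPTIONS --safe #-}

-- Put M = d. The kernel of the d × (d + 1) matrix A below is spanned by the primitive vector
-- κ = (−(Mᵈ + 1), Mᵈ, Mᵈ⁻¹, …, M), while the columns of A have norm at most M + 1. Take b = A z
-- with z = (Mᵈ, −1, Mᵈ, …, Mᵈ): the integer solutions of A x = b are the z + k κ, where the
-- coordinate 1 is negative for k ≤ 0 and the coordinate 0 is negative for k ≥ 1, whereas all
-- coordinates of z + κ/2 are at least (Mᵈ − 2)/2.
module Submission where

open import Algebra.Bundles.Raw using (RawSemiring)
open import Algebra.Definitions.RawMonoid using (sum)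
import Algebra.Properties.CommutativeMonoid.Sum as Sum
open import Data.Fin.Base using (Fin; zero; suc; inject₁; fromℕ)
open import Data.Integer.Base as ℤ using (ℤ; 0ℤ; 1ℤ; +_)
import Data.Integer.Properties as ℤ
open import Data.Integer.Tactic.RingSolver using (solve-∀)
open import Data.Nat.Base as ℕ using (ℕ; zero; suc; z≤n; s≤s)
import Data.Nat.Properties as ℕ
import Data.Nat.Tactic.RingSolver as ℕ-Solver
open import Data.Product.Base using (Σ-syntax; _×_; _,_; proj₁)
open import Data.Rational.Base as ℚ using (ℚ; ½)
import Data.Rational.Properties as ℚ
import Data.Rational.Unnormalised.Base as ℚᵘ
import Data.Rational.Unnormalised.Properties as ℚᵘ
open import Data.Vec.Functional as Vector using (Vector)
open import Function.Base using (_∘_)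
open import Relation.Binary.PropositionalEquality
  using (_≡_; refl; sym; trans; cong; cong₂; subst; subst₂; module ≡-Reasoning)
open import Relation.Nullary using (yes; no)
open import Relation.Nullary.Negation using (¬_)
open import Relation.Unary using (_∈_)
open import Defs
open Aux using (ι; toℚᵘ-ι; ι-*; ι-+; isqrt)

-- Dot products and unit vectors.

infix 8 _∙_

_∙_ : ∀ {n} → Vector ℤ n → Vector ℤ n → ℤ
a ∙ x = sum ℤ.+-0-rawMonoid (λ j → a j ℤ.* x j)

0∙ : ∀ {n} (x : Vector ℤ n) → (λ _ → 0ℤ) ∙ x ≡ 0ℤ
0∙ {n} x = Sum.sum-replicate-zero ℤ.+-0-commutativeMonoid n

unit : ∀ {n} → Fin n → Vector ℤ n
unit zero    zero    = 1ℤ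
unit zero    (suc _) = 0ℤ
unit (suc _) zero    = 0ℤ
unit (suc k) (suc j) = unit k j

unit∙ : ∀ {n} (k : Fin n) (x : Vector ℤ n) → unit k ∙ x ≡ x k
unit∙ zero    x = trans (cong₂ ℤ._+_ (ℤ.*-identityˡ (x zero)) (0∙ (x ∘ suc))) (ℤ.+-identityʳ (x zero))
unit∙ (suc k) x = trans (ℤ.+-identityˡ _) (unit∙ k (x ∘ suc))

∣unit∣²≤1 : ∀ {n} (k j : Fin n) → ℤ.∣ unit k j ∣ ℕ.* ℤ.∣ unit k j ∣ ℕ.≤ 1
∣unit∣²≤1 zero    zero    = ℕ.≤-refl
∣unit∣²≤1 zero    (suc _) = z≤n
∣unit∣²≤1 (suc _) zero    = z≤n
∣unit∣²≤1 (suc k) (suc j) = ∣unit∣²≤1 k j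

normSq-0 : ∀ n → normSq {n} (λ _ → 0ℤ) ≡ 0
normSq-0 n = Sum.sum-replicate-zero ℕ.+-0-commutativeMonoid n

-- Bidiagonal rows and geometric sequences.

chain : ∀ (M : ℕ) {m} → Matrix ℤ m (suc m)
chain M zero    zero          = 1ℤ
chain M zero    (suc zero)    = ℤ.- + M
chain M zero    (suc (suc _)) = 0ℤ
chain M (suc i) zero          = 0ℤ
chain M (suc i) (suc j)       = chain M i j

chain∙ : ∀ M {m} (i : Fin m) x → chain M i ∙ x ≡ x (inject₁ i) ℤ.- + M ℤ.* x (suc i)
chain∙ M zero    x = trans
  (cong (λ s → 1ℤ ℤ.* x zero ℤ.+ (ℤ.- + M ℤ.* x (suc zero) ℤ.+ s)) (0∙ (λ j → x (suc (suc j)))))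
  (lemma (+ M) (x zero) (x (suc zero)))
  where
  lemma : ∀ M x y → 1ℤ ℤ.* x ℤ.+ (ℤ.- M ℤ.* y ℤ.+ 0ℤ) ≡ x ℤ.- M ℤ.* y
  lemma = solve-∀
chain∙ M (suc i) x = trans (ℤ.+-identityˡ _) (chain∙ M i (x ∘ suc))

normSq-chain₀≤1 : ∀ M {m} → normSq (column (chain M {m}) zero) ℕ.≤ 1
normSq-chain₀≤1 M {zero}  = z≤n
normSq-chain₀≤1 M {suc m} = ℕ.≤-reflexive (cong suc (normSq-0 m))

-- A column contains at most one entry -M, with at most one entry 1 directly below it.
normSq-chain≤ : ∀ M {m} (j : Fin (suc m)) → normSq (column (chain M) j) ℕ.≤ M ℕ.* M ℕ.+ 1
normSq-chain≤ M {m}     zero          = ℕ.≤-trans (normSq-chain₀≤1 M {m}) (ℕ.m≤n+m 1 (M ℕ.* M))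
normSq-chain≤ M {suc m} (suc zero)    = ℕ.+-mono-≤
  (ℕ.≤-reflexive (cong₂ ℕ._*_ (ℤ.∣-i∣≡∣i∣ (+ M)) (ℤ.∣-i∣≡∣i∣ (+ M)))) (normSq-chain₀≤1 M {m})
normSq-chain≤ M {suc m} (suc (suc j)) = normSq-chain≤ M (suc j)

-- A kernel vector of `chain M` is thus fixed by its last entry: each step towards the front
-- multiplies by M.
chain-telescope : ∀ M {m} (u : Vector ℤ (suc m)) →
  (∀ i → u (inject₁ i) ≡ + M ℤ.* u (suc i)) → u zero ≡ + (M ℕ.^ m) ℤ.* u (fromℕ m)
chain-telescope M {zero}  u step = sym (ℤ.*-identityˡ (u zero))
chain-telescope M {suc m} u step = begin
  u zero                                              ≡⟨ step zero ⟩
  + M ℤ.* u (suc zero)                                ≡⟨ cong (+ M ℤ.*_) (chain-telescope M (u ∘ suc) (step ∘ suc)) ⟩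
  + M ℤ.* (+ (M ℕ.^ m) ℤ.* u (fromℕ (suc m)))         ≡⟨ sym (ℤ.*-assoc (+ M) (+ (M ℕ.^ m)) _) ⟩
  + M ℤ.* + (M ℕ.^ m) ℤ.* u (fromℕ (suc m))           ≡⟨ cong (ℤ._* u (fromℕ (suc m))) (sym (ℤ.pos-* M (M ℕ.^ m))) ⟩
  + (M ℕ.^ suc m) ℤ.* u (fromℕ (suc m))               ∎
  where open ≡-Reasoning

-- The coordinates of `κ` after the first. They end in M, not in 1, because row 0 of the matrix
-- makes the last coordinate of an integral kernel vector a multiple of M.
powers : ∀ (M : ℕ) {m} → Vector ℕ (suc m)
powers M {m}     zero    = M ℕ.^ suc m
powers M {suc m} (suc k) = powers M k

powers-step : ∀ M {m} (i : Fin m) → powers M (inject₁ i) ≡ M ℕ.* powers M (suc i)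
powers-step M {suc m} zero    = refl
powers-step M {suc m} (suc i) = powers-step M i

powers-last : ∀ M m → powers M (fromℕ m) ≡ M
powers-last M zero    = ℕ.*-identityʳ M
powers-last M (suc m) = powers-last M m

-- Bounds for norms and powers.

⌈√⌉≤ : ∀ N c → N ℕ.≤ c ℕ.* c → proj₁ ⌈√ N ⌉ ℕ.≤ c
-- The case split repeats the one that computes `⌈√ N ⌉`, so that its value reduces. In both
-- branches a smaller c would have c² < N.
⌈√⌉≤ N c N≤c² with isqrt N
... | m , m²≤N , N<[1+m]² with m ℕ.* m ℕ.<? N
...   | yes m²<N = ℕ.≰⇒> λ c≤m → ℕ.<⇒≱ m²<N (ℕ.≤-trans N≤c² (ℕ.*-mono-≤ c≤m c≤m))
...   | no  _    = ℕ.≮⇒≥ λ c<m → ℕ.<⇒≱ (ℕ.*-mono-< c<m c<m) (ℕ.≤-trans m²≤N N≤c²)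

foldr-⊔-lub : ∀ {n} (f : Vector ℕ n) c → (∀ j → f j ℕ.≤ c) → Vector.foldr ℕ._⊔_ 0 f ℕ.≤ c
foldr-⊔-lub {zero}  f c f≤c = z≤n
foldr-⊔-lub {suc n} f c f≤c = ℕ.⊔-lub (f≤c zero) (foldr-⊔-lub (f ∘ suc) c (f≤c ∘ suc))

Δ≤ : ∀ {d n} (A : Matrix ℤ d n) c → (∀ j → normSq (column A j) ℕ.≤ c ℕ.* c) → Δ A ℕ.≤ c
Δ≤ A c norm≤ = foldr-⊔-lub (λ j → ⌈‖ column A j ‖⌉) c (λ j → ⌈√⌉≤ (normSq (column A j)) c (norm≤ j))

-- Consecutive squares differ by 2n + 1, which is at least 2 because n = `suc m` is positive.
n²+2≤[1+n]² : ∀ m → suc m ℕ.* suc m ℕ.+ 2 ℕ.≤ suc (suc m) ℕ.* suc (suc m)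
n²+2≤[1+n]² m = subst (suc m ℕ.* suc m ℕ.+ 2 ℕ.≤_) (square m) (ℕ.m≤m+n _ (suc (m ℕ.+ m)))
  where
  square : ∀ m → suc m ℕ.* suc m ℕ.+ 2 ℕ.+ suc (m ℕ.+ m) ≡ suc (suc m) ℕ.* suc (suc m)
  square = ℕ-Solver.solve-∀

-- Induction on k: one more factor 1 + M adds the term (k + 1) Mᵏ, and k + 1 ≤ M bounds it by a
-- single further Mᵏ⁺¹.
[1+M]^k≤[1+k]M^k : ∀ M k → k ℕ.≤ M → suc M ℕ.^ k ℕ.≤ suc k ℕ.* M ℕ.^ k
[1+M]^k≤[1+k]M^k M zero    _   = ℕ.≤-refl
[1+M]^k≤[1+k]M^k M (suc k) k<M = begin
  suc M ℕ.* suc M ℕ.^ k                           ≤⟨ ℕ.*-monoʳ-≤ (suc M) ([1+M]^k≤[1+k]M^k M k (ℕ.<⇒≤ k<M)) ⟩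
  suc M ℕ.* (suc k ℕ.* M ℕ.^ k)                   ≡⟨ expand M k (M ℕ.^ k) ⟩
  suc k ℕ.* M ℕ.^ k ℕ.+ suc k ℕ.* (M ℕ.* M ℕ.^ k) ≤⟨ ℕ.+-monoˡ-≤ _ (ℕ.*-monoˡ-≤ (M ℕ.^ k) k<M) ⟩
  suc (suc k) ℕ.* M ℕ.^ suc k                     ∎
  where
  open ℕ.≤-Reasoning
  expand : ∀ M k p → suc M ℕ.* (suc k ℕ.* p) ≡ suc k ℕ.* p ℕ.+ suc k ℕ.* (M ℕ.* p)
  expand = ℕ-Solver.solve-∀

-- Half-integral vectors as real solutions.

half : ℤ → ℚ
half i = ι i ℚ.* ½

half-double : ∀ i → half (i ℤ.+ i) ≡ ι i
half-double i = trans (cong (ℚ._* ½) (ι-+ i i))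
  (trans (ℚ.*-distribʳ-+ ½ (ι i) (ι i)) (Aux.½+½ (ι i)))

/≤half : ∀ p q .{{_ : ℕ.NonZero q}} i → p ℤ.* + 2 ℤ.≤ i ℤ.* + q → p ℚ./ q ℚ.≤ half i
/≤half p q@(suc q-1) i le = ℚ.toℚᵘ-cancel-≤
  (ℚᵘ.≤-respˡ-≃ (ℚᵘ.≃-sym (ℚ.toℚᵘ-fromℚᵘ (ℚᵘ.mkℚᵘ p q-1)))
  (ℚᵘ.≤-respʳ-≃ (ℚᵘ.≃-sym (ℚᵘ.≃-trans (ℚ.toℚᵘ-homo-* (ι i) ½) (ℚᵘ.*-congʳ (toℚᵘ-ι i))))
    (ℚᵘ.*≤* (subst (λ r → p ℤ.* + 2 ℤ.≤ r ℤ.* + q) (sym (ℤ.*-identityʳ i)) le))))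

threshold≤half : ∀ d 2≤d D i → + (D ℕ.^ d) ℤ.* + 2 ℤ.≤ i ℤ.* + (20 ℕ.* d) → threshold d 2≤d D ℚ.≤ half i
threshold≤half d 2≤d D = /≤half (+ (D ℕ.^ d)) (20 ℕ.* d)
  where
  instance
    d≢0   = ℕ.>-nonZero (ℕ.<-trans (s≤s z≤n) 2≤d)
    20d≢0 = ℕ.m*n≢0 20 d

-- Sums and products of constant sequences are constant, so the real dot product has the same
-- rational value at every index.
seq-∙-half : ∀ {n} (a w : Vector ℤ n) k →
  seq (sum (RawSemiring.+-rawMonoid ℝ-rawSemiring) (λ j → fromℤ (a j) *ᴿ fromℚ (half (w j)))) k
    ≡ half (a ∙ w)
seq-∙-half {zero}  a w k = refl
seq-∙-half {suc n} a w k = begin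
  ι (a zero) ℚ.* (ι (w zero) ℚ.* ½) ℚ.+ _
    ≡⟨ cong₂ ℚ._+_ (trans (sym (ℚ.*-assoc (ι (a zero)) (ι (w zero)) ½)) (cong (ℚ._* ½) (sym (ι-* (a zero) (w zero)))))
                   (seq-∙-half (a ∘ suc) (w ∘ suc) k) ⟩
  half (a zero ℤ.* w zero) ℚ.+ half ((a ∘ suc) ∙ (w ∘ suc))
    ≡⟨ sym (ℚ.*-distribʳ-+ ½ (ι (a zero ℤ.* w zero)) (ι ((a ∘ suc) ∙ (w ∘ suc)))) ⟩
  (ι (a zero ℤ.* w zero) ℚ.+ ι ((a ∘ suc) ∙ (w ∘ suc))) ℚ.* ½
    ≡⟨ cong (ℚ._* ½) (sym (ι-+ (a zero ℤ.* w zero) ((a ∘ suc) ∙ (w ∘ suc)))) ⟩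
  half (a ∙ w) ∎
  where open ≡-Reasoning

-- The real point is w/2; existence over the reals is reduced to an identity in integers and
-- rational bounds.
half-solution : ∀ {d n} (A : Matrix ℤ d n) {b : Vector ℤ d} {t} (w : Vector ℤ n) →
  (∀ j → t ℚ.≤ half (w j)) → (∀ i → (A ·ᶻ w) i ≡ b i ℤ.+ b i) →
  (fromℤ ∘ b) ∈ RealImage≥ A t
half-solution A {b} {t} w t≤ Aw≡2b = (λ j → fromℚ (half (w j))) ,
  (λ j ε ε>0 → 0 , λ _ _ → ℚ.≤-trans (t≤ j)
    (ℚ.≤-trans (ℚ.≤-reflexive (sym (ℚ.+-identityʳ (half (w j))))) (ℚ.+-monoʳ-≤ (half (w j)) (ℚ.<⇒≤ ε>0)))) ,
  (λ i ε ε>0 → 0 , λ k _ → ℚ.≤-trans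
    (ℚ.≤-reflexive (cong ℚ.∣_∣ (trans
      (cong (λ q → ι (b i) ℚ.- q) (trans (seq-∙-half (A i) w k) (trans (cong half (Aw≡2b i)) (half-double (b i)))))
      (ℚ.+-inverseʳ (ι (b i))))))
    (ℚ.<⇒≤ ε>0))

-- The matrix and its column norms.

module Construction (m : ℕ) where

  M P : ℕ
  M = suc (suc m)
  P = M ℕ.^ M

  -- The chain rows leave x₀ and the last coordinate free in the kernel; row 0, M x₀ + M x₁ + x_M,
  -- ties them together. Short columns thereby force a kernel vector with entries of size Mᴹ.
  A : Matrix ℤ M (suc M)
  A zero    zero          = + M
  A zero    (suc zero)    = + M
  A zero    (suc (suc k)) = unit (fromℕ m) k
  A (suc i) zero          = 0ℤ
  A (suc i) (suc k)       = chain M i k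

  row₀ : ∀ x → (A ·ᶻ x) zero ≡ + M ℤ.* x zero ℤ.+ (+ M ℤ.* x (suc zero) ℤ.+ x (fromℕ M))
  row₀ x = cong (λ s → + M ℤ.* x zero ℤ.+ (+ M ℤ.* x (suc zero) ℤ.+ s))
    (unit∙ (fromℕ m) (λ k → x (suc (suc k))))

  row₊ : ∀ x i → (A ·ᶻ x) (suc i) ≡ x (suc (inject₁ i)) ℤ.- + M ℤ.* x (suc (suc i))
  row₊ x i = trans (ℤ.+-identityˡ _) (chain∙ M i (x ∘ suc))

  -- Every column has squared norm at most M² + 2, hence at most (M + 1)².
  Δ≤1+M : Δ A ℕ.≤ suc M
  Δ≤1+M = Δ≤ A (suc M) λ j → ℕ.≤-trans (column≤ j) (n²+2≤[1+n]² (suc m))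
    where
    column≤ : ∀ j → normSq (column A j) ℕ.≤ M ℕ.* M ℕ.+ 2
    column≤ zero          = ℕ.+-monoʳ-≤ (M ℕ.* M) (ℕ.≤-trans (ℕ.≤-reflexive (normSq-0 (suc m))) z≤n)
    column≤ (suc zero)    = ℕ.+-monoʳ-≤ (M ℕ.* M) (ℕ.≤-trans (normSq-chain₀≤1 M {suc m}) (s≤s z≤n))
    column≤ (suc (suc k)) = ℕ.≤-trans
      (ℕ.+-mono-≤ (∣unit∣²≤1 (fromℕ m) k) (normSq-chain≤ M (suc k)))
      (ℕ.≤-reflexive (sym (ℕ.+-suc (M ℕ.* M) 1)))

  -- The right-hand side and a real solution above the threshold.

  z κ w : Vector ℤ (suc M)
  z zero          = + P
  z (suc zero)    = ℤ.- 1ℤ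
  z (suc (suc _)) = + P
  κ zero          = ℤ.- (+ P ℤ.+ 1ℤ)
  κ (suc k)       = + powers M k
  -- Twice the real solution z + κ/2, so that the computation stays in the integers.
  w j             = z j ℤ.+ z j ℤ.+ κ j

  b : Vector ℤ M
  b = A ·ᶻ z

  -- This amounts to A κ = 0: in row 0 the terms -M (P + 1), M P and M cancel, and in the chain rows
  -- consecutive powers differ by the factor M.
  Aw≡2b : ∀ i → (A ·ᶻ w) i ≡ b i ℤ.+ b i
  Aw≡2b zero    = begin
    (A ·ᶻ w) zero
      ≡⟨ row₀ w ⟩
    + M ℤ.* w zero ℤ.+ (+ M ℤ.* w (suc zero) ℤ.+ w (fromℕ M))
      ≡⟨ cong (λ l → + M ℤ.* w zero ℤ.+ (+ M ℤ.* w (suc zero) ℤ.+ (z (fromℕ M) ℤ.+ z (fromℕ M) ℤ.+ + l)))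
           (powers-last M (suc m)) ⟩
    + M ℤ.* w zero ℤ.+ (+ M ℤ.* w (suc zero) ℤ.+ (z (fromℕ M) ℤ.+ z (fromℕ M) ℤ.+ + M))
      ≡⟨ lemma (+ M) (+ P) (z zero) (z (suc zero)) (z (fromℕ M)) ⟩
    _ ≡⟨ cong₂ ℤ._+_ (sym (row₀ z)) (sym (row₀ z)) ⟩
    b zero ℤ.+ b zero ∎
    where
    open ≡-Reasoning
    lemma : ∀ M P z₀ z₁ zₗ →
      M ℤ.* (z₀ ℤ.+ z₀ ℤ.+ ℤ.- (P ℤ.+ 1ℤ)) ℤ.+ (M ℤ.* (z₁ ℤ.+ z₁ ℤ.+ P) ℤ.+ (zₗ ℤ.+ zₗ ℤ.+ M))
        ≡ (M ℤ.* z₀ ℤ.+ (M ℤ.* z₁ ℤ.+ zₗ)) ℤ.+ (M ℤ.* z₀ ℤ.+ (M ℤ.* z₁ ℤ.+ zₗ))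
    lemma = solve-∀
  Aw≡2b (suc i) = begin
    (A ·ᶻ w) (suc i)
      ≡⟨ row₊ w i ⟩
    w (suc (inject₁ i)) ℤ.- + M ℤ.* w (suc (suc i))
      ≡⟨ cong (λ p → zₐ ℤ.+ zₐ ℤ.+ p ℤ.- + M ℤ.* w (suc (suc i)))
           (trans (cong +_ (powers-step M i)) (ℤ.pos-* M (powers M (suc i)))) ⟩
    zₐ ℤ.+ zₐ ℤ.+ + M ℤ.* + powers M (suc i) ℤ.- + M ℤ.* w (suc (suc i))
      ≡⟨ lemma (+ M) (+ powers M (suc i)) zₐ (z (suc (suc i))) ⟩
    _ ≡⟨ cong₂ ℤ._+_ (sym (row₊ z i)) (sym (row₊ z i)) ⟩
    b (suc i) ℤ.+ b (suc i) ∎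
    where
    open ≡-Reasoning
    zₐ = z (suc (inject₁ i))
    lemma : ∀ M p x y → x ℤ.+ x ℤ.+ M ℤ.* p ℤ.- M ℤ.* (y ℤ.+ y ℤ.+ p)
                          ≡ (x ℤ.- M ℤ.* y) ℤ.+ (x ℤ.- M ℤ.* y)
    lemma = solve-∀

  P-2≤w : ∀ j → + P ℤ.- + 2 ℤ.≤ w j
  P-2≤w zero          = subst (+ P ℤ.- + 2 ℤ.≤_) (lemma (+ P)) (ℤ.i≤i+j (+ P ℤ.- + 2) (+ 1))
    where
    lemma : ∀ P → P ℤ.- + 2 ℤ.+ + 1 ≡ P ℤ.+ P ℤ.+ ℤ.- (P ℤ.+ 1ℤ)
    lemma = solve-∀
  -- Coordinate 1 attains the minimum, since z₁ = -1 costs 2.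
  P-2≤w (suc zero)    = ℤ.≤-reflexive (ℤ.+-comm (+ P) (ℤ.- + 2))
  P-2≤w (suc (suc k)) = subst (+ P ℤ.- + 2 ℤ.≤_) (lemma (+ P) (+ powers M (suc k)))
    (ℤ.i≤i+j (+ P ℤ.- + 2) (+ (P ℕ.+ 2 ℕ.+ powers M (suc k))))
    where
    lemma : ∀ P p → P ℤ.- + 2 ℤ.+ (P ℤ.+ + 2 ℤ.+ p) ≡ P ℤ.+ P ℤ.+ p
    lemma = solve-∀

  4≤P : 4 ℕ.≤ P
  4≤P = ℕ.≤-trans (ℕ.^-monoˡ-≤ 2 {2} {M} (s≤s (s≤s z≤n))) (ℕ.^-monoʳ-≤ M {2} {M} (s≤s (s≤s z≤n)))

  -- This is Dᴹ/(20M) ≤ (P - 2)/2 with denominators and subtraction cleared. From (M + 1)ᴹ ≤ (M + 1)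
  -- P ≤ 2MP the first term is at most 4MP; the second is 10M · 4 ≤ 10MP as P ≥ 4, and 14MP fits
  -- into 20MP.
  D^M-bound : ∀ D → D ℕ.≤ suc M → D ℕ.^ M ℕ.* 2 ℕ.+ 2 ℕ.* (20 ℕ.* M) ℕ.≤ P ℕ.* (20 ℕ.* M)
  D^M-bound D D≤1+M = begin
    D ℕ.^ M ℕ.* 2 ℕ.+ 2 ℕ.* (20 ℕ.* M)
      ≤⟨ ℕ.+-monoˡ-≤ (2 ℕ.* (20 ℕ.* M)) (ℕ.*-monoˡ-≤ 2
           (ℕ.≤-trans (ℕ.^-monoˡ-≤ M D≤1+M) ([1+M]^k≤[1+k]M^k M M ℕ.≤-refl))) ⟩
    suc M ℕ.* P ℕ.* 2 ℕ.+ 2 ℕ.* (20 ℕ.* M)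
      ≤⟨ ℕ.+-monoˡ-≤ (2 ℕ.* (20 ℕ.* M)) (ℕ.*-monoˡ-≤ 2 (ℕ.*-monoˡ-≤ P (ℕ.+-monoˡ-≤ M (s≤s (z≤n {suc m}))))) ⟩
    (M ℕ.+ M) ℕ.* P ℕ.* 2 ℕ.+ 2 ℕ.* (20 ℕ.* M)
      ≡⟨ regroup M P ⟩
    4 ℕ.* M ℕ.* P ℕ.+ 10 ℕ.* M ℕ.* 4
      ≤⟨ ℕ.+-monoʳ-≤ (4 ℕ.* M ℕ.* P) (ℕ.*-monoʳ-≤ (10 ℕ.* M) 4≤P) ⟩
    4 ℕ.* M ℕ.* P ℕ.+ 10 ℕ.* M ℕ.* P
      ≤⟨ ℕ.m≤m+n _ (6 ℕ.* M ℕ.* P) ⟩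
    4 ℕ.* M ℕ.* P ℕ.+ 10 ℕ.* M ℕ.* P ℕ.+ 6 ℕ.* M ℕ.* P
      ≡⟨ collect M P ⟩
    P ℕ.* (20 ℕ.* M) ∎
    where
    open ℕ.≤-Reasoning
    regroup : ∀ M P → (M ℕ.+ M) ℕ.* P ℕ.* 2 ℕ.+ 2 ℕ.* (20 ℕ.* M) ≡ 4 ℕ.* M ℕ.* P ℕ.+ 10 ℕ.* M ℕ.* 4
    regroup = ℕ-Solver.solve-∀
    collect : ∀ M P → 4 ℕ.* M ℕ.* P ℕ.+ 10 ℕ.* M ℕ.* P ℕ.+ 6 ℕ.* M ℕ.* P ≡ P ℕ.* (20 ℕ.* M)
    collect = ℕ-Solver.solve-∀

  threshold≤w : ∀ 2≤M D → D ℕ.≤ suc M → ∀ j → threshold M 2≤M D ℚ.≤ half (w j)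
  threshold≤w 2≤M D D≤1+M j = threshold≤half M 2≤M D (w j) (begin
    + (D ℕ.^ M) ℤ.* + 2                            ≡⟨ sym (ℤ.pos-* (D ℕ.^ M) 2) ⟩
    + (D ℕ.^ M ℕ.* 2)                              ≡⟨ sym (cancel (+ (D ℕ.^ M ℕ.* 2)) (+ (2 ℕ.* K))) ⟩
    + (D ℕ.^ M ℕ.* 2 ℕ.+ 2 ℕ.* K) ℤ.- + (2 ℕ.* K)  ≤⟨ ℤ.+-monoˡ-≤ (ℤ.- + (2 ℕ.* K)) (ℤ.+≤+ (D^M-bound D D≤1+M)) ⟩
    + (P ℕ.* K) ℤ.- + (2 ℕ.* K)                    ≡⟨ cong₂ ℤ._-_ (ℤ.pos-* P K) (ℤ.pos-* 2 K) ⟩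
    + P ℤ.* + K ℤ.- + 2 ℤ.* + K                    ≡⟨ factor (+ P) (+ K) ⟩
    (+ P ℤ.- + 2) ℤ.* + K                          ≤⟨ ℤ.*-monoʳ-≤-nonNeg (+ K) (P-2≤w j) ⟩
    w j ℤ.* + K                                    ∎)
    where
    open ℤ.≤-Reasoning
    K : ℕ
    K = 20 ℕ.* M
    cancel : ∀ x y → x ℤ.+ y ℤ.- y ≡ x
    cancel = solve-∀
    factor : ∀ P K → P ℤ.* K ℤ.- + 2 ℤ.* K ≡ (P ℤ.- + 2) ℤ.* K
    factor = solve-∀

  real-solution : ∀ 2≤M D → D ℕ.≤ suc M → (fromℤ ∘ b) ∈ RealImage≥ A (threshold M 2≤M D)
  real-solution 2≤M D D≤1+M = half-solution A {b} w (threshold≤w 2≤M D D≤1+M) Aw≡2b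

  -- The difference of two integer solutions is the multiple v κ of κ, with v = −(u₀ + u₁).
  no-solution : ¬ (Σ[ x ∈ Vector ℤ (suc M) ] ((∀ j → 0ℤ ℤ.≤ x j) × (∀ i → b i ≡ (A ·ᶻ x) i)))
  no-solution (x , x≥0 , b≡Ax) = v≯0 (ℤ.≰⇒> v≰0)
    where
    open ≡-Reasoning

    u : Vector ℤ (suc M)
    u j = x j ℤ.- z j

    v : ℤ
    v = ℤ.- (u zero ℤ.+ u (suc zero))

    u-step : ∀ i → u (suc (inject₁ i)) ≡ + M ℤ.* u (suc (suc i))
    u-step i = ℤ.i-j≡0⇒i≡j _ _ (begin
      u (suc (inject₁ i)) ℤ.- + M ℤ.* u (suc (suc i))
        ≡⟨ lemma (+ M) (x (suc (inject₁ i))) (x (suc (suc i))) (z (suc (inject₁ i))) (z (suc (suc i))) ⟩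
      (x (suc (inject₁ i)) ℤ.- + M ℤ.* x (suc (suc i))) ℤ.- (z (suc (inject₁ i)) ℤ.- + M ℤ.* z (suc (suc i)))
        ≡⟨ cong₂ ℤ._-_ (sym (row₊ x i)) (sym (row₊ z i)) ⟩
      (A ·ᶻ x) (suc i) ℤ.- b (suc i)
        ≡⟨ ℤ.i≡j⇒i-j≡0 (sym (b≡Ax (suc i))) ⟩
      0ℤ ∎)
      where
      lemma : ∀ M x y x′ y′ → (x ℤ.- x′) ℤ.- M ℤ.* (y ℤ.- y′) ≡ (x ℤ.- M ℤ.* y) ℤ.- (x′ ℤ.- M ℤ.* y′)
      lemma = solve-∀

    -- Row 0 applied to u gives M u₀ + M u₁ + u_M = 0, which makes u_M a multiple of M with integral
    -- quotient v.
    u-last : u (fromℕ M) ≡ + M ℤ.* v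
    u-last = ℤ.i-j≡0⇒i≡j _ _ (begin
      u (fromℕ M) ℤ.- + M ℤ.* v
        ≡⟨ lemma (+ M) (x zero) (x (suc zero)) (x (fromℕ M)) (z zero) (z (suc zero)) (z (fromℕ M)) ⟩
      _ ≡⟨ cong₂ ℤ._-_ (sym (row₀ x)) (sym (row₀ z)) ⟩
      (A ·ᶻ x) zero ℤ.- b zero
        ≡⟨ ℤ.i≡j⇒i-j≡0 (sym (b≡Ax zero)) ⟩
      0ℤ ∎)
      where
      lemma : ∀ M x₀ x₁ xₗ z₀ z₁ zₗ →
        (xₗ ℤ.- zₗ) ℤ.- M ℤ.* (ℤ.- ((x₀ ℤ.- z₀) ℤ.+ (x₁ ℤ.- z₁)))
          ≡ (M ℤ.* x₀ ℤ.+ (M ℤ.* x₁ ℤ.+ xₗ)) ℤ.- (M ℤ.* z₀ ℤ.+ (M ℤ.* z₁ ℤ.+ zₗ))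
      lemma = solve-∀

    u₁≡Pv : u (suc zero) ≡ + P ℤ.* v
    u₁≡Pv = begin
      u (suc zero)                              ≡⟨ chain-telescope M (u ∘ suc) u-step ⟩
      + (M ℕ.^ suc m) ℤ.* u (fromℕ M)           ≡⟨ cong (+ (M ℕ.^ suc m) ℤ.*_) u-last ⟩
      + (M ℕ.^ suc m) ℤ.* (+ M ℤ.* v)           ≡⟨ lemma (+ (M ℕ.^ suc m)) (+ M) v ⟩
      + M ℤ.* + (M ℕ.^ suc m) ℤ.* v             ≡⟨ cong (ℤ._* v) (sym (ℤ.pos-* M (M ℕ.^ suc m))) ⟩
      + P ℤ.* v                                 ∎
      where
      lemma : ∀ q M v → q ℤ.* (M ℤ.* v) ≡ M ℤ.* q ℤ.* v
      lemma = solve-∀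

    x₁+1≡Pv : x (suc zero) ℤ.+ 1ℤ ≡ + P ℤ.* v
    -- Since z₁ = -1, u₁ unfolds to x₁ + 1.
    x₁+1≡Pv = u₁≡Pv

    x₀+v≡P[1-v] : x zero ℤ.+ v ≡ + P ℤ.* (1ℤ ℤ.- v)
    x₀+v≡P[1-v] = begin
      x zero ℤ.+ v                ≡⟨ lemma (x zero) (+ P) (u (suc zero)) ⟩
      + P ℤ.- u (suc zero)        ≡⟨ cong (λ y → + P ℤ.- y) u₁≡Pv ⟩
      + P ℤ.- + P ℤ.* v           ≡⟨ factor (+ P) v ⟩
      + P ℤ.* (1ℤ ℤ.- v)          ∎
      where
      lemma : ∀ x P u₁ → x ℤ.+ ℤ.- ((x ℤ.- P) ℤ.+ u₁) ≡ P ℤ.- u₁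
      lemma = solve-∀
      factor : ∀ P v → P ℤ.- P ℤ.* v ≡ P ℤ.* (1ℤ ℤ.- v)
      factor = solve-∀

    -- Otherwise x₁ + 1 = P v would be at most 0.
    v≰0 : ¬ v ℤ.≤ 0ℤ
    v≰0 v≤0 = ℤ.<⇒≱ (ℤ.+-mono-≤-< (x≥0 (suc zero)) (ℤ.+<+ (s≤s z≤n)))
      (subst₂ ℤ._≤_ (sym x₁+1≡Pv) (ℤ.*-zeroʳ (+ P)) (ℤ.*-monoˡ-≤-nonNeg (+ P) v≤0))

    -- Integrality turns v > 0 into v ≥ 1, so x₀ + v = P (1 - v) would be at most 0. The real
    -- solution, with v = 1/2, escapes at this point.
    v≯0 : ¬ 0ℤ ℤ.< v
    v≯0 0<v = ℤ.<⇒≱ (ℤ.+-mono-≤-< (x≥0 zero) 0<v)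
      (subst₂ ℤ._≤_ (sym x₀+v≡P[1-v]) (ℤ.*-zeroʳ (+ P)) (ℤ.*-monoˡ-≤-nonNeg (+ P)
        (ℤ.i≤j⇒i-j≤0 (ℤ.i<j⇒suc[i]≤j 0<v))))

theorem1p3 : (d : ℕ) (2≤d : 2 ℕ.≤ d) →
    Σ[ n ∈ ℕ ] Σ[ A ∈ Matrix ℤ d n ] Σ[ b ∈ Vector ℤ d ]
    ( 1 ℕ.≤ n
    × b ∈ ℒ A
    × (fromℤ ∘ b) ∈ RealImage≥ A (threshold d 2≤d (Δ A))
    × ¬ (Σ[ x ∈ Vector ℤ n ] ((∀ j → 0ℤ ℤ.≤ x j) × (∀ i → b i ≡ (A ·ᶻ x) i))) )
theorem1p3 (suc zero)    (s≤s ())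
theorem1p3 (suc (suc m)) 2≤d =
  -- The let keeps D from being inferred by unification, which would unfold Δ.
  let x-real = real-solution 2≤d (Δ A) Δ≤1+M
  in suc M , A , b , s≤s z≤n , (z , λ _ → refl) , x-real , no-solution
  where open Construction m
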